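{- For every integer $m \geqslant 1$, the function $\tau_m : \mathbb{Z}_2^{2m} \to \mathbb{Z}_2$ (the non-diagonal-symmetry function defined in the context) is a bent function on $\mathbb{Z}_2^{2m}$.
   Context: Bent functions. The Sylvester Hadamard matrix $H_n$ of order $2^n$ is defined by $H_1 := \begin{pmatrix} 1 & 1 \\ 1 & -1 \end{pmatrix}$ and $H_n := H_{n-1} \otimes H_1$ for $n > 1$. For a Boolean function $f : \mathbb{Z}_2^n \to \mathbb{Z}_2$, let $\underline{f} := [(-1)^{f[0]}, (-1)^{f[1]}, \ldots, (-1)^{f[2^n-1]}]^T$, where $f[i]$ is the value of $f$ on the $n$ binary digits of $i$. The function $f$ is bent if every entry of $H_n \underline{f}$ has the same absolute value, i.e. $|H_n \underline{f}| = C[1,\ldots,1]^T$ (entrywise absolute value) for some constant $C$. Basis matrices. Let $\mathrm{E}_1 := \begin{pmatrix} 0 & -1 \\ 1 & 0 \end{pmatrix}$ and $\mathrm{E}_2 := \begin{pmatrix} 0 & 1 \\ 1 & 0 \end{pmatrix}$. Define $\gamma_1$ on $\mathbb{Z}_2^2$ (bit pairs) by $\gamma_1(00) = I$, $\gamma_1(01) = \mathrm{E}_1$, $\gamma_1(10) = \mathrm{E}_2$, $\gamma_1(11) = \mathrm{E}_1\mathrm{E}_2$. For $m > 1$, define $\gamma_m$ on $\mathbb{Z}_2^{2m}$ by $\gamma_m(p \odot i) := \gamma_1(p) \otimes \gamma_{m-1}(i)$ for $p \in \mathbb{Z}_2^2$, $i \in \mathbb{Z}_2^{2m-2}$, where $\odot$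 denotes concatenation of bit vectors and $\otimes$ the Kronecker product. (The $2^m \times 2^m$ matrices $\gamma_m(i)$, $i \in \mathbb{Z}_2^{2m}$, form a basis of the real representation of the Clifford algebra $\mathbb{R}_{m,m}$; each squares to $I$ or $-I$.) Sign-of-square function. $\sigma_m : \mathbb{Z}_2^{2m} \to \mathbb{Z}_2$ is defined by $\sigma_m(i) = 1$ if $\gamma_m(i)^2 = -I$, and $\sigma_m(i) = 0$ if $\gamma_m(i)^2 = I$. Non-diagonal-symmetry function. $\tau_m : \mathbb{Z}_2^{2m} \to \mathbb{Z}_2$ is defined recursively: $\tau_1(10) = 1$ and $\tau_1(00)=\tau_1(01)=\tau_1(11) = 0$; for $m > 1$ and $i \in \mathbb{Z}_2^{2m-2}$, $\tau_m(00 \odot i) := \tau_{m-1}(i)$, $\tau_m(01 \odot i) := \sigma_{m-1}(i)$, $\tau_m(10 \odot i) := \sigma_{m-1}(i) + 1$, $\tau_m(11 \odot i) := \tau_{m-1}(i)$, with addition in $\mathbb{Z}_2$. -}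

module Defs where

open import Data.Bool.Base using (if_then_else_)
open import Data.Fin.Base using (Fin; cast; finToFun; quotient; remainder)
open import Data.Fin.Patterns using (0F; 1F)
import Data.Fin.Properties as Fin
open import Data.Integer.Base as ℤ using (ℤ; 0ℤ; 1ℤ; -1ℤ; ∣_∣)
import Data.Integer.Properties as ℤ
open import Data.Nat.Base as ℕ using (ℕ; suc; NonZero)
import Data.Nat.Properties as ℕ
open import Data.Parity.Base as ℙ using (Parity; 0ℙ; 1ℙ)
open import Data.Product.Base using (∃-syntax)
open import Data.Vec.Base as Vec using (Vec; []; _∷_)
import Data.Vec.Functional as F
open import Relation.Binary.PropositionalEquality.Core using (_≡_)
open import Relation.Nullary.Decidable using (Dec; does)

open import Algebra.Properties.Semiring.Sum ℤ.+-*-semiring using (sum)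

-- ℤ₂ is Parity, with the addition of Data.Parity.Base.
BoolFun : ℕ → Set
BoolFun n = Vec Parity n → Parity

-- All matrices involved have integer entries, so ℤ stands in for ℝ.
Matrix : ℕ → Set
Matrix n = Fin n → Fin n → ℤ

infix 4 _≐_ _≐?_
infixl 7 _·_ _⊗_
infix 8 -ᴹ_

_≐_ : ∀ {n} → Matrix n → Matrix n → Set
A ≐ B = ∀ i j → A i j ≡ B i j

_≐?_ : ∀ {n} (A B : Matrix n) → Dec (A ≐ B)
A ≐? B = Fin.all? λ i → Fin.all? λ j → A i j ℤ.≟ B i j

𝟙 : ∀ {n} → Matrix n
𝟙 i j = if does (i Fin.≟ j) then 1ℤ else 0ℤ

-ᴹ_ : ∀ {n} → Matrix n → Matrix n
(-ᴹ A) i j = ℤ.- A i j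

_·_ : ∀ {n} → Matrix n → Matrix n → Matrix n
(A · B) i j = sum λ k → A i k ℤ.* B k j

_·ᵛ_ : ∀ {n} → Matrix n → F.Vector ℤ n → F.Vector ℤ n
(A ·ᵛ v) i = sum λ k → A i k ℤ.* v k

_⊗_ : ∀ {m n} → Matrix m → Matrix n → Matrix (m ℕ.* n)
_⊗_ {m} {n} A B i j =
  A (quotient n i) (quotient n j) ℤ.* B (remainder {m} n i) (remainder {m} n j)

matrix₂ : (a b c d : ℤ) → Matrix 2
matrix₂ a b c d = (a F.∷ b F.∷ F.[]) F.∷ (c F.∷ d F.∷ F.[]) F.∷ F.[]

H₁ : Matrix 2
H₁ = matrix₂ 1ℤ 1ℤ
             1ℤ -1ℤ

-- The cast only reconciles 2 ^ (n + 1) = 2 * 2 ^ n with the order 2 ^ n * 2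
-- of the Kronecker product.
H : ∀ n → .{{NonZero n}} → Matrix (2 ℕ.^ n)
H 1               = H₁
H (suc n@(suc _)) = λ i j → (H n ⊗ H₁) (cast eq i) (cast eq j)
  where
  eq : 2 ℕ.^ suc n ≡ 2 ℕ.^ n ℕ.* 2
  eq = ℕ.*-comm 2 (2 ℕ.^ n)

bit : Fin 2 → Parity
bit 0F = 0ℙ
bit 1F = 1ℙ

-- Most significant digit first.
digits : ∀ n → Fin (2 ℕ.^ n) → Vec Parity n
digits n i = Vec.tabulate λ k → bit (finToFun {2} {n} i k)

[-1]^_ : Parity → ℤ
[-1]^ 0ℙ = 1ℤ
[-1]^ 1ℙ = -1ℤ

signVector : ∀ {n} → BoolFun n → F.Vector ℤ (2 ℕ.^ n)
signVector {n} f i = [-1]^ f (digits n i)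

IsBent : ∀ {n} → .{{NonZero n}} → BoolFun n → Set
IsBent {n} f = ∃[ C ] (∀ i → ∣ (H n ·ᵛ signVector f) i ∣ ≡ C)

E₁ E₂ : Matrix 2
E₁ = matrix₂ 0ℤ -1ℤ
             1ℤ 0ℤ
E₂ = matrix₂ 0ℤ 1ℤ
             1ℤ 0ℤ

γ₁ : Vec Parity 2 → Matrix 2
γ₁ (0ℙ ∷ 0ℙ ∷ []) = 𝟙
γ₁ (0ℙ ∷ 1ℙ ∷ []) = E₁
γ₁ (1ℙ ∷ 0ℙ ∷ []) = E₂
γ₁ (1ℙ ∷ 1ℙ ∷ []) = E₁ · E₂

-- ℤ₂^{2m} is written with length m * 2, so that it computes to 2 + (m - 1) * 2.
γ : ∀ m → .{{NonZero m}} → Vec Parity (m ℕ.* 2) → Matrix (2 ℕ.^ m)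
γ 1               p           = γ₁ p
γ (suc m@(suc _)) (a ∷ b ∷ i) = γ₁ (a ∷ b ∷ []) ⊗ γ m i

-- Every γ m i squares to 𝟙 or to -ᴹ 𝟙, so the else branch is exactly the
-- case where the square is 𝟙.
σ : ∀ m → .{{NonZero m}} → BoolFun (m ℕ.* 2)
σ m i = if does (γ m i · γ m i ≐? -ᴹ 𝟙) then 1ℙ else 0ℙ

τ : ∀ m → .{{NonZero m}} → BoolFun (m ℕ.* 2)
τ 1               (0ℙ ∷ 0ℙ ∷ []) = 0ℙ
τ 1               (0ℙ ∷ 1ℙ ∷ []) = 0ℙ
τ 1               (1ℙ ∷ 0ℙ ∷ []) = 1ℙ
τ 1               (1ℙ ∷ 1ℙ ∷ []) = 0ℙ
τ (suc m@(suc _)) (0ℙ ∷ 0ℙ ∷ i)  = τ m i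
τ (suc m@(suc _)) (0ℙ ∷ 1ℙ ∷ i)  = σ m i
τ (suc m@(suc _)) (1ℙ ∷ 0ℙ ∷ i)  = σ m i ℙ.+ 1ℙ
τ (suc m@(suc _)) (1ℙ ∷ 1ℙ ∷ i)  = τ m i

{-# OPTIONS --safe #-}

-- Write F̂ for the Walsh–Hadamard transform of (-1)^F.  Splitting off the first
-- two bits in the recursion for τ gives, for x ∈ ℤ₂² and u ∈ ℤ₂^{2m},
-- τ̂_{m+1}(x ⊙ u) = 2 τ̂_m(u) if x has even weight, and ± 2 σ̂_m(u) otherwise.
-- By the mixed-product rule the squares of the γ_m multiply along ⊗, so
-- σ_{m+1}(p ⊙ i) = σ₁(p) + σ_m(i) and σ̂_{m+1}(x ⊙ u) = ± 2 σ̂_m(u).  Hence all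
-- values of σ̂_m and τ̂_m are ± 2^m.
module Submission where

open import Defs
open import Algebra.Properties.CommutativeSemigroup using (interchange)
open import Data.Bool.Base using (if_then_else_)
open import Data.Fin.Base
  using (Fin; zero; suc; toℕ; cast; combine; quotient; remainder; _↑ˡ_; _↑ʳ_)
open import Data.Fin.Patterns using (0F; 1F)
import Data.Fin.Properties as Fin
open import Data.Integer.Base as ℤ using (ℤ; 1ℤ; -1ℤ; ∣_∣)
import Data.Integer.Properties as ℤ
open import Data.Integer.Tactic.RingSolver using (solve-∀)
open import Data.Nat.Base as ℕ using (ℕ; zero; suc; NonZero; _*_; _^_)
open import Data.Nat.Properties using (m*n≢0; *-comm)
import Data.Nat.Tactic.RingSolver as ℕ
open import Data.Parity.Base as ℙ using (Parity; 0ℙ; 1ℙ)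
import Data.Parity.Properties as ℙ
open import Data.Product.Base using (_,_; proj₁; proj₂)
open import Data.Vec.Base using (Vec; []; _∷_)
open import Function.Base using (_∘_)
open import Relation.Binary.PropositionalEquality
  using (_≡_; _≗_; refl; sym; trans; cong; cong₂; module ≡-Reasoning)
open import Relation.Nullary.Decidable using (yes; no; from-yes; dec-true; dec-false)
open import Relation.Nullary.Negation using (¬_)

open import Algebra.Properties.Semiring.Sum ℤ.+-*-semiring
  using (sum; sum-cong-≗; *-distribˡ-sum; *-distribʳ-sum)

open ≡-Reasoning

-- Indices of Kronecker products and sums over them.

quotient-combine : ∀ {m n} (i : Fin m) (j : Fin n) → quotient {m} n (combine i j) ≡ i
quotient-combine i j = cong proj₁ (Fin.remQuot-combine i j)

remainder-combine : ∀ {m n} (i : Fin m) (j : Fin n) → remainder {m} n (combine i j) ≡ j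
remainder-combine i j = cong proj₂ (Fin.remQuot-combine i j)

combine-quotient-remainder : ∀ {m} n (i : Fin (m * n)) →
  combine (quotient {m} n i) (remainder {m} n i) ≡ i
combine-quotient-remainder {m} n i = Fin.combine-remQuot {m} n i

-- Both sides have the numerical value `n * o * i + o * j + k`. This is associativity of the
-- Kronecker product at the level of indices.
combine-assoc : ∀ {m n o} .(eq : m * (n * o) ≡ m * n * o) (i : Fin m) (j : Fin n) (k : Fin o) →
  cast eq (combine i (combine j k)) ≡ combine (combine i j) k
combine-assoc {m} {n} {o} eq i j k = Fin.toℕ-injective (begin
  toℕ (cast eq (combine i (combine j k)))          ≡⟨ Fin.toℕ-cast eq _ ⟩
  toℕ (combine i (combine j k))                    ≡⟨ Fin.toℕ-combine i (combine j k) ⟩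
  n * o * toℕ i ℕ.+ toℕ (combine j k)              ≡⟨ cong (n * o * toℕ i ℕ.+_) (Fin.toℕ-combine j k) ⟩
  n * o * toℕ i ℕ.+ (o * toℕ j ℕ.+ toℕ k)          ≡⟨ regroup n o (toℕ i) (toℕ j) (toℕ k) ⟩
  o * (n * toℕ i ℕ.+ toℕ j) ℕ.+ toℕ k              ≡⟨ cong (λ a → o * a ℕ.+ toℕ k) (Fin.toℕ-combine i j) ⟨
  o * toℕ (combine i j) ℕ.+ toℕ k                  ≡⟨ Fin.toℕ-combine (combine i j) k ⟨
  toℕ (combine (combine i j) k)                    ∎)
  where
  regroup : ∀ n o a b c → n * o * a ℕ.+ (o * b ℕ.+ c) ≡ o * (n * a ℕ.+ b) ℕ.+ c
  regroup = ℕ.solve-∀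

sum-+ : ∀ m {n} (f : Fin (m ℕ.+ n) → ℤ) →
  sum f ≡ sum (λ i → f (i ↑ˡ n)) ℤ.+ sum (λ j → f (m ↑ʳ j))
sum-+ zero    f = sym (ℤ.+-identityˡ _)
sum-+ (suc m) f = trans (cong (ℤ._+_ (f zero)) (sum-+ m (f ∘ suc))) (sym (ℤ.+-assoc (f zero) _ _))

sum-combine : ∀ m n (f : Fin (m * n) → ℤ) →
  sum f ≡ sum {m} λ i → sum {n} λ j → f (combine i j)
sum-combine zero    n f = refl
sum-combine (suc m) n f = trans (sum-+ n f)
  (cong (ℤ._+_ (sum λ j → f (j ↑ˡ m * n))) (sum-combine m n (λ k → f (n ↑ʳ k))))

sum-product : ∀ m n (f : Fin m → ℤ) (g : Fin n → ℤ) →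
  (sum {m * n} λ k → f (quotient {m} n k) ℤ.* g (remainder {m} n k)) ≡ sum f ℤ.* sum g
sum-product m n f g = begin
  (sum {m * n} λ k → f (quotient {m} n k) ℤ.* g (remainder {m} n k))
    ≡⟨ sum-combine m n (λ k → f (quotient {m} n k) ℤ.* g (remainder {m} n k)) ⟩
  (sum {m} λ i → sum {n} λ j → f (quotient {m} n (combine i j)) ℤ.* g (remainder {m} n (combine i j)))
    ≡⟨ (sum-cong-≗ λ i → sum-cong-≗ λ j →
          cong₂ (λ a b → f a ℤ.* g b) (quotient-combine i j) (remainder-combine i j)) ⟩
  (sum λ i → sum λ j → f i ℤ.* g j)
    ≡⟨ (sum-cong-≗ λ i → *-distribˡ-sum (f i) g) ⟨
  (sum λ i → f i ℤ.* sum g)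
    ≡⟨ *-distribʳ-sum (sum g) f ⟨
  sum f ℤ.* sum g ∎

-- Kronecker products of matrices.

⊗-cong : ∀ {m n} {A C : Matrix m} {B D : Matrix n} → A ≐ C → B ≐ D → A ⊗ B ≐ C ⊗ D
⊗-cong A≐C B≐D i j = cong₂ ℤ._*_ (A≐C _ _) (B≐D _ _)

-- Each summand regroups into a factor depending only on the quotient of `k` and one depending only
-- on its remainder, so `sum-product` splits the sum.
mixed-product : ∀ {m n} (A C : Matrix m) (B D : Matrix n) →
  (A ⊗ B) · (C ⊗ D) ≐ (A · C) ⊗ (B · D)
mixed-product {m} {n} A C B D i j = trans
  (sum-cong-≗ {m * n} λ k → interchange ℤ.*-commutativeSemigroup (A (quotient {m} n i) (quotient {m} n k)) _
    (C (quotient {m} n k) (quotient {m} n j)) _)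
  (sum-product m n (λ k → A (quotient {m} n i) k ℤ.* C k (quotient {m} n j))
    (λ k → B (remainder {m} n i) k ℤ.* D k (remainder {m} n j)))

𝟙-⊗-𝟙 : ∀ {m n} → 𝟙 {m} ⊗ 𝟙 {n} ≐ 𝟙
𝟙-⊗-𝟙 {m} {n} i j with i Fin.≟ j
... | yes refl
  rewrite dec-true (quotient {m} n i Fin.≟ quotient {m} n i) refl
        | dec-true (remainder {m} n i Fin.≟ remainder {m} n i) refl = refl
... | no i≢j with quotient {m} n i Fin.≟ quotient {m} n j | remainder {m} n i Fin.≟ remainder {m} n j
...   | no  _ | _     = refl
...   | yes _ | no _  = refl
...   | yes q | yes r with () ← i≢j (begin
  i                                              ≡⟨ combine-quotient-remainder {m} n i ⟨
  combine (quotient {m} n i) (remainder {m} n i) ≡⟨ cong₂ combine q r ⟩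
  combine (quotient {m} n j) (remainder {m} n j) ≡⟨ combine-quotient-remainder {m} n j ⟩
  j                                              ∎)

-- Squares of the basis matrices, and recursions for `σ` and `τ`.

[-1]^-homo-+ : ∀ p q → [-1]^ (p ℙ.+ q) ≡ [-1]^ p ℤ.* [-1]^ q
[-1]^-homo-+ 0ℙ 0ℙ = refl
[-1]^-homo-+ 0ℙ 1ℙ = refl
[-1]^-homo-+ 1ℙ 0ℙ = refl
[-1]^-homo-+ 1ℙ 1ℙ = refl

∣[-1]^p*i∣≡∣i∣ : ∀ p i → ∣ [-1]^ p ℤ.* i ∣ ≡ ∣ i ∣
∣[-1]^p*i∣≡∣i∣ 0ℙ i = cong ∣_∣ (ℤ.*-identityˡ i)
∣[-1]^p*i∣≡∣i∣ 1ℙ i = trans (cong ∣_∣ (ℤ.-1*i≡-i i)) (ℤ.∣-i∣≡∣i∣ i)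

±𝟙 : ∀ {n} → Parity → Matrix n
±𝟙 p i j = [-1]^ p ℤ.* 𝟙 i j

±𝟙-⊗-±𝟙 : ∀ {m n} p q → ±𝟙 {m} p ⊗ ±𝟙 {n} q ≐ ±𝟙 (p ℙ.+ q)
±𝟙-⊗-±𝟙 {m} {n} p q i j = begin
  [-1]^ p ℤ.* I ℤ.* ([-1]^ q ℤ.* J)        ≡⟨ interchange ℤ.*-commutativeSemigroup ([-1]^ p) I ([-1]^ q) J ⟩
  [-1]^ p ℤ.* [-1]^ q ℤ.* (I ℤ.* J)        ≡⟨ cong₂ ℤ._*_ (sym ([-1]^-homo-+ p q)) (𝟙-⊗-𝟙 {m} {n} i j) ⟩
  [-1]^ (p ℙ.+ q) ℤ.* 𝟙 i j                ∎
  where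
  I = 𝟙 (quotient {m} n i) (quotient {m} n j)
  J = 𝟙 (remainder {m} n i) (remainder {m} n j)

σ₁ : Parity → Parity → Parity
σ₁ 0ℙ 1ℙ = 1ℙ
σ₁ _  _  = 0ℙ

-- σʳ and τʳ start their recursions at the constant 0 for m = 0, which reproduces
-- σ₁ and τ₁ as the case m = 1.
σʳ : ∀ m → BoolFun (m * 2)
σʳ zero    []          = 0ℙ
σʳ (suc m) (a ∷ b ∷ i) = σ₁ a b ℙ.+ σʳ m i

τʳ : ∀ m → BoolFun (m * 2)
τʳ zero    []            = 0ℙ
τʳ (suc m) (0ℙ ∷ 0ℙ ∷ i) = τʳ m i
τʳ (suc m) (0ℙ ∷ 1ℙ ∷ i) = σʳ m i
τʳ (suc m) (1ℙ ∷ 0ℙ ∷ i) = 1ℙ ℙ.+ σʳ m i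
τʳ (suc m) (1ℙ ∷ 1ℙ ∷ i) = τʳ m i

γ₁-square : ∀ a b → γ₁ (a ∷ b ∷ []) · γ₁ (a ∷ b ∷ []) ≐ ±𝟙 (σ₁ a b)
γ₁-square 0ℙ 0ℙ = from-yes (γ₁ (0ℙ ∷ 0ℙ ∷ []) · γ₁ (0ℙ ∷ 0ℙ ∷ []) ≐? ±𝟙 0ℙ)
γ₁-square 0ℙ 1ℙ = from-yes (γ₁ (0ℙ ∷ 1ℙ ∷ []) · γ₁ (0ℙ ∷ 1ℙ ∷ []) ≐? ±𝟙 1ℙ)
γ₁-square 1ℙ 0ℙ = from-yes (γ₁ (1ℙ ∷ 0ℙ ∷ []) · γ₁ (1ℙ ∷ 0ℙ ∷ []) ≐? ±𝟙 0ℙ)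
γ₁-square 1ℙ 1ℙ = from-yes (γ₁ (1ℙ ∷ 1ℙ ∷ []) · γ₁ (1ℙ ∷ 1ℙ ∷ []) ≐? ±𝟙 0ℙ)

γ-square : ∀ m .{{_ : NonZero m}} i → γ m i · γ m i ≐ ±𝟙 (σʳ m i)
-- Here `σʳ` unfolds to `σ₁ a b ℙ.+ 0ℙ`, which reduces to `σ₁ a b` only once the bits are concrete.
γ-square 1 (0ℙ ∷ 0ℙ ∷ []) = γ₁-square 0ℙ 0ℙ
γ-square 1 (0ℙ ∷ 1ℙ ∷ []) = γ₁-square 0ℙ 1ℙ
γ-square 1 (1ℙ ∷ 0ℙ ∷ []) = γ₁-square 1ℙ 0ℙ
γ-square 1 (1ℙ ∷ 1ℙ ∷ []) = γ₁-square 1ℙ 1ℙ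
γ-square (suc m@(suc _)) (a ∷ b ∷ i) k l = begin
  (γ (suc m) (a ∷ b ∷ i) · γ (suc m) (a ∷ b ∷ i)) k l
    ≡⟨ mixed-product {2} A A (γ m i) (γ m i) k l ⟩
  (_⊗_ {2} {2 ^ m} (A · A) (γ m i · γ m i)) k l
    ≡⟨ ⊗-cong {2} {A = A · A} {±𝟙 (σ₁ a b)} {γ m i · γ m i} {±𝟙 (σʳ m i)}
         (γ₁-square a b) (γ-square m i) k l ⟩
  (_⊗_ {2} {2 ^ m} (±𝟙 (σ₁ a b)) (±𝟙 (σʳ m i))) k l
    ≡⟨ ±𝟙-⊗-±𝟙 {2} {2 ^ m} (σ₁ a b) (σʳ m i) k l ⟩
  ±𝟙 (σ₁ a b ℙ.+ σʳ m i) k l ∎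
  where
  A = γ₁ (a ∷ b ∷ [])

-- The diagonal entries at the given index would equate 1 and -1. An index must be supplied because
-- at order 0 the two matrices agree vacuously.
𝟙≭-𝟙 : ∀ {n} → Fin n → ¬ (±𝟙 {n} 0ℙ ≐ -ᴹ 𝟙)
𝟙≭-𝟙 i eq with e ← eq i i rewrite dec-true (i Fin.≟ i) refl with () ← e

zeroIndex : ∀ m → Fin (2 ^ m)
zeroIndex zero    = zero
zeroIndex (suc m) = combine {2} 0F (zeroIndex m)

-- The sign of the square found in `γ-square` settles the test inside `σ`, as `𝟙` and `-ᴹ 𝟙` differ
-- at the positive order `2 ^ m`.
σ≗σʳ : ∀ m .{{_ : NonZero m}} i → σ m i ≡ σʳ m i
σ≗σʳ m i with σʳ m i | γ-square m i
... | 0ℙ | sq = cong (if_then 1ℙ else 0ℙ)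
  (dec-false (γ m i · γ m i ≐? -ᴹ 𝟙)
    λ eq → 𝟙≭-𝟙 (zeroIndex m) λ k l → trans (sym (sq k l)) (eq k l))
... | 1ℙ | sq = cong (if_then 1ℙ else 0ℙ)
  (dec-true (γ m i · γ m i ≐? -ᴹ 𝟙) λ k l → trans (sq k l) (ℤ.-1*i≡-i (𝟙 k l)))

τ≗τʳ : ∀ m .{{_ : NonZero m}} i → τ m i ≡ τʳ m i
τ≗τʳ 1 (0ℙ ∷ 0ℙ ∷ []) = refl
τ≗τʳ 1 (0ℙ ∷ 1ℙ ∷ []) = refl
τ≗τʳ 1 (1ℙ ∷ 0ℙ ∷ []) = refl
τ≗τʳ 1 (1ℙ ∷ 1ℙ ∷ []) = refl
τ≗τʳ (suc m@(suc _)) (0ℙ ∷ 0ℙ ∷ i) = τ≗τʳ m i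
τ≗τʳ (suc m@(suc _)) (0ℙ ∷ 1ℙ ∷ i) = σ≗σʳ m i
τ≗τʳ (suc m@(suc _)) (1ℙ ∷ 0ℙ ∷ i) =
  -- `τʳ` has `1ℙ` on the left, so that `walsh-[-1]^-1+` serves the shifted branches of both `σʳ`
  -- and `τʳ`.
  trans (cong (ℙ._+ 1ℙ) (σ≗σʳ m i)) (ℙ.+-comm (σʳ m i) 1ℙ)
τ≗τʳ (suc m@(suc _)) (1ℙ ∷ 1ℙ ∷ i) = τ≗τʳ m i

-- The Walsh-Hadamard transform and its agreement with `H`.

-- At `u` this is the sum over all `v` of `F v` times -1 to the power of the dot product of `u` and
-- `v`. It is evaluated one leading bit at a time, to match the recursions of `σʳ` and `τʳ`.
walsh : ∀ {n} → (Vec Parity n → ℤ) → Vec Parity n → ℤ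
walsh F []      = F []
walsh F (x ∷ u) = walsh (F ∘ (0ℙ ∷_)) u ℤ.+ [-1]^ x ℤ.* walsh (F ∘ (1ℙ ∷_)) u

walsh-cong : ∀ {n} {F G : Vec Parity n → ℤ} → F ≗ G → walsh F ≗ walsh G
walsh-cong F≗G []      = F≗G []
walsh-cong F≗G (x ∷ u) = cong₂ (λ a b → a ℤ.+ [-1]^ x ℤ.* b)
  (walsh-cong (F≗G ∘ (0ℙ ∷_)) u) (walsh-cong (F≗G ∘ (1ℙ ∷_)) u)

walsh-scale : ∀ {n} c (F : Vec Parity n → ℤ) u → walsh (λ v → c ℤ.* F v) u ≡ c ℤ.* walsh F u
walsh-scale c F []      = refl
walsh-scale c F (x ∷ u) = trans
  (cong₂ (λ a b → a ℤ.+ [-1]^ x ℤ.* b)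
    (walsh-scale c (F ∘ (0ℙ ∷_)) u) (walsh-scale c (F ∘ (1ℙ ∷_)) u))
  (factor c ([-1]^ x) _ _)
  where
  factor : ∀ c s a b → c ℤ.* a ℤ.+ s ℤ.* (c ℤ.* b) ≡ c ℤ.* (a ℤ.+ s ℤ.* b)
  factor = solve-∀

⊗-combine : ∀ {m n} (A : Matrix m) (B : Matrix n) i j k l →
  (A ⊗ B) (combine i j) (combine k l) ≡ A i k ℤ.* B j l
⊗-combine A B i j k l = cong₂ ℤ._*_
  (cong₂ A (quotient-combine i j) (quotient-combine k l))
  (cong₂ B (remainder-combine i j) (remainder-combine k l))

-- An index is cut into a leading, a middle and a last block, and `combine-assoc` regroups them.
-- This compares splitting off the first digit with splitting off the last.
cast-combine : ∀ {m n k} o .(eq₁ : m * k ≡ m * n * o) (eq₂ : k ≡ n * o) (i : Fin (m * k)) →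
  let j = cast eq₂ (remainder {m} k i) in
  cast eq₁ i ≡ combine (combine (quotient {m} k i) (quotient {n} o j)) (remainder {n} o j)
-- With `k` a variable, `eq₂` can be matched with `refl`, which turns the inner cast into the
-- identity.
cast-combine {m} {n} o eq₁ refl i rewrite Fin.cast-is-id refl (remainder {m} (n * o) i) = begin
  cast eq₁ i                          ≡⟨ cong (cast eq₁) (combine-quotient-remainder {m} (n * o) i) ⟨
  cast eq₁ (combine q r)              ≡⟨ cong (cast eq₁ ∘ combine q) (combine-quotient-remainder {n} o r) ⟨
  cast eq₁ (combine q (combine a b))  ≡⟨ combine-assoc {m} {n} {o} eq₁ q a b ⟩
  combine (combine q a) b             ∎
  where
  q = quotient {m} (n * o) i
  r = remainder {m} (n * o) i
  a = quotient {n} o r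
  b = remainder {n} o r

-- The recursion for H splits off the last digit, those for digits and walsh the first.
H≐H₁⊗H : ∀ n → H (suc (suc n)) ≐ H₁ ⊗ H (suc n)
H≐H₁⊗H zero = from-yes (H 2 ≐? H₁ ⊗ H 1)
H≐H₁⊗H (suc n) i j = begin
  (H (suc (suc n)) ⊗ H₁) (cast eq₁ i) (cast eq₁ j)
    ≡⟨ cong₂ (H (suc (suc n)) ⊗ H₁)
         (cast-combine {2} {2 ^ suc n} 2 eq₁ eq₂ i) (cast-combine {2} {2 ^ suc n} 2 eq₁ eq₂ j) ⟩
  (H (suc (suc n)) ⊗ H₁) (combine (combine (q i) (a i)) (b i)) (combine (combine (q j) (a j)) (b j))
    ≡⟨ ⊗-combine (H (suc (suc n))) H₁ (combine (q i) (a i)) (b i) (combine (q j) (a j)) (b j) ⟩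
  H (suc (suc n)) (combine (q i) (a i)) (combine (q j) (a j)) ℤ.* H₁ (b i) (b j)
    ≡⟨ cong (ℤ._* H₁ (b i) (b j)) (H≐H₁⊗H n _ _) ⟩
  (H₁ ⊗ H (suc n)) (combine (q i) (a i)) (combine (q j) (a j)) ℤ.* H₁ (b i) (b j)
    ≡⟨ cong (ℤ._* H₁ (b i) (b j)) (⊗-combine H₁ (H (suc n)) (q i) (a i) (q j) (a j)) ⟩
  H₁ (q i) (q j) ℤ.* H (suc n) (a i) (a j) ℤ.* H₁ (b i) (b j)
    ≡⟨ ℤ.*-assoc (H₁ (q i) (q j)) _ _ ⟩
  (H₁ ⊗ H (suc (suc n))) i j ∎
  where
  eq₁ : 2 ^ suc (suc (suc n)) ≡ 2 ^ suc (suc n) * 2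
  eq₁ = *-comm 2 (2 ^ suc (suc n))

  eq₂ : 2 ^ suc (suc n) ≡ 2 ^ suc n * 2
  eq₂ = *-comm 2 (2 ^ suc n)

  q : Fin (2 ^ suc (suc (suc n))) → Fin 2
  q = quotient {2} (2 ^ suc (suc n))

  r : Fin (2 ^ suc (suc (suc n))) → Fin (2 ^ suc n * 2)
  r k = cast eq₂ (remainder {2} (2 ^ suc (suc n)) k)

  a : Fin (2 ^ suc (suc (suc n))) → Fin (2 ^ suc n)
  a k = quotient {2 ^ suc n} 2 (r k)

  b : Fin (2 ^ suc (suc (suc n))) → Fin 2
  b k = remainder {2 ^ suc n} 2 (r k)

sum-H₁ : ∀ a (f : Fin 2 → ℤ) → sum (λ b → H₁ a b ℤ.* f b) ≡ f 0F ℤ.+ [-1]^ (bit a) ℤ.* f 1F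
sum-H₁ 0F f = cong₂ ℤ._+_ (ℤ.*-identityˡ (f 0F)) (ℤ.+-identityʳ _)
sum-H₁ 1F f = cong₂ ℤ._+_ (ℤ.*-identityˡ (f 0F)) (ℤ.+-identityʳ _)

-- Induction on the leading digit: by `H≐H₁⊗H` the inner sums are transforms of the restrictions of
-- `F` to a fixed first bit, and `H₁` combines the two as `walsh` does.
H-walsh : ∀ n .{{_ : NonZero n}} (F : Vec Parity n → ℤ) i →
  (H n ·ᵛ (F ∘ digits n)) i ≡ walsh F (digits n i)
-- The quotient hidden in `digits 1 i` reduces only at a concrete index.
H-walsh 1 F 0F = sum-H₁ 0F (F ∘ digits 1)
H-walsh 1 F 1F = sum-H₁ 1F (F ∘ digits 1)
H-walsh (suc n@(suc n-1)) F i = begin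
  (sum λ k → H (suc n) i k ℤ.* F (digits (suc n) k))
    ≡⟨ (sum-cong-≗ λ k → cong (ℤ._* F (digits (suc n) k)) (H≐H₁⊗H n-1 i k)) ⟩
  (sum λ k → (H₁ ⊗ H n) i k ℤ.* F (bit (quotient {2} N k) ∷ digits n (remainder {2} N k)))
    ≡⟨ sum-combine 2 N (λ k → (H₁ ⊗ H n) i k ℤ.*
         F (bit (quotient {2} N k) ∷ digits n (remainder {2} N k))) ⟩
  (sum {2} λ b → sum {N} λ j → (H₁ ⊗ H n) i (combine b j) ℤ.*
    F (bit (quotient {2} N (combine b j)) ∷ digits n (remainder {2} N (combine b j))))
    ≡⟨ (sum-cong-≗ λ b → sum-cong-≗ λ j → cong₂
         (λ c k → H₁ q c ℤ.* H n r k ℤ.* F (bit c ∷ digits n k))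
         (quotient-combine b j) (remainder-combine b j)) ⟩
  (sum λ b → sum λ j → H₁ q b ℤ.* H n r j ℤ.* F (bit b ∷ digits n j))
    ≡⟨ (sum-cong-≗ λ b → trans
         (sum-cong-≗ λ j → ℤ.*-assoc (H₁ q b) (H n r j) _)
         (sym (*-distribˡ-sum (H₁ q b) λ j → H n r j ℤ.* F (bit b ∷ digits n j)))) ⟩
  (sum λ b → H₁ q b ℤ.* (H n ·ᵛ (F ∘ (bit b ∷_) ∘ digits n)) r)
    ≡⟨ (sum-cong-≗ λ b → cong (H₁ q b ℤ.*_) (H-walsh n (F ∘ (bit b ∷_)) r)) ⟩
  (sum λ b → H₁ q b ℤ.* walsh (F ∘ (bit b ∷_)) (digits n r))
    ≡⟨ sum-H₁ q (λ b → walsh (F ∘ (bit b ∷_)) (digits n r)) ⟩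
  walsh F (digits (suc n) i) ∎
  where
  N = 2 ^ n
  q = quotient {2} N i
  r = remainder {2} N i

-- Absolute values of the two transforms.

σ̂ τ̂ : ∀ m → Vec Parity (m * 2) → ℤ
σ̂ m = walsh ([-1]^_ ∘ σʳ m)
τ̂ m = walsh ([-1]^_ ∘ τʳ m)

walsh-[-1]^-1+ : ∀ {n} (f : BoolFun n) u →
  walsh (λ v → [-1]^ (1ℙ ℙ.+ f v)) u ≡ -1ℤ ℤ.* walsh ([-1]^_ ∘ f) u
walsh-[-1]^-1+ f u = trans
  (walsh-cong (λ v → [-1]^-homo-+ 1ℙ (f v)) u)
  (walsh-scale -1ℤ ([-1]^_ ∘ f) u)

∣±2i∣ : ∀ p i {k} → ∣ i ∣ ≡ k → ∣ [-1]^ p ℤ.* (ℤ.+ 2 ℤ.* i) ∣ ≡ 2 * k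
∣±2i∣ p i refl = trans (∣[-1]^p*i∣≡∣i∣ p (ℤ.+ 2 ℤ.* i)) (ℤ.abs-* (ℤ.+ 2) i)

∣σ̂∣≡2^m : ∀ m u → ∣ σ̂ m u ∣ ≡ 2 ^ m
∣σ̂∣≡2^m zero    []          = refl
-- Fixing the first two bits of `σʳ (suc m)` leaves `σʳ m`, except at 01, where its complement
-- appears. The rewrite turns that branch into minus the transform.
∣σ̂∣≡2^m (suc m) (x ∷ y ∷ u) rewrite walsh-[-1]^-1+ (σʳ m) u =
  -- The factor of `σ̂ m u` is 2 for `y = 1ℙ` and plus or minus 2, with the sign of `x`, for
  -- `y = 0ℙ`; hence the exponent `x (1 + y)`.
  trans (cong ∣_∣ (signs x y (σ̂ m u))) (∣±2i∣ (x ℙ.* (1ℙ ℙ.+ y)) (σ̂ m u) (∣σ̂∣≡2^m m u))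
  where
  signs : ∀ x y s →
    s ℤ.+ [-1]^ y ℤ.* (-1ℤ ℤ.* s) ℤ.+ [-1]^ x ℤ.* (s ℤ.+ [-1]^ y ℤ.* s)
      ≡ [-1]^ (x ℙ.* (1ℙ ℙ.+ y)) ℤ.* (ℤ.+ 2 ℤ.* s)
  signs 0ℙ 0ℙ = solve-∀
  signs 0ℙ 1ℙ = solve-∀
  signs 1ℙ 0ℙ = solve-∀
  signs 1ℙ 1ℙ = solve-∀

∣τ̂∣≡2^m : ∀ m u → ∣ τ̂ m u ∣ ≡ 2 ^ m
∣τ̂∣≡2^m zero    []          = refl
∣τ̂∣≡2^m (suc m) (x ∷ y ∷ u) rewrite walsh-[-1]^-1+ (σʳ m) u = values x y
  where
  s = σ̂ m u
  t = τ̂ m u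

  -- The branches 00, 01, 10, 11 contribute `t`, `s`, minus `s`, `t`. The opposite signs of `s` and
  -- equal signs of `t` make `s` cancel when `x` equals `y`, and `t` cancel otherwise.
  even₀ : ∀ s t → t ℤ.+ 1ℤ ℤ.* s ℤ.+ 1ℤ ℤ.* (-1ℤ ℤ.* s ℤ.+ 1ℤ ℤ.* t) ≡ 1ℤ ℤ.* (ℤ.+ 2 ℤ.* t)
  even₀ = solve-∀

  even₁ : ∀ s t → t ℤ.+ -1ℤ ℤ.* s ℤ.+ -1ℤ ℤ.* (-1ℤ ℤ.* s ℤ.+ -1ℤ ℤ.* t) ≡ 1ℤ ℤ.* (ℤ.+ 2 ℤ.* t)
  even₁ = solve-∀

  odd₀ : ∀ s t → t ℤ.+ 1ℤ ℤ.* s ℤ.+ -1ℤ ℤ.* (-1ℤ ℤ.* s ℤ.+ 1ℤ ℤ.* t) ≡ 1ℤ ℤ.* (ℤ.+ 2 ℤ.* s)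
  odd₀ = solve-∀

  odd₁ : ∀ s t → t ℤ.+ -1ℤ ℤ.* s ℤ.+ 1ℤ ℤ.* (-1ℤ ℤ.* s ℤ.+ -1ℤ ℤ.* t) ≡ -1ℤ ℤ.* (ℤ.+ 2 ℤ.* s)
  odd₁ = solve-∀

  values : ∀ x y →
    ∣ t ℤ.+ [-1]^ y ℤ.* s ℤ.+ [-1]^ x ℤ.* (-1ℤ ℤ.* s ℤ.+ [-1]^ y ℤ.* t) ∣ ≡ 2 ^ suc m
  values 0ℙ 0ℙ = trans (cong ∣_∣ (even₀ s t)) (∣±2i∣ 0ℙ t (∣τ̂∣≡2^m m u))
  values 0ℙ 1ℙ = trans (cong ∣_∣ (odd₁ s t)) (∣±2i∣ 1ℙ s (∣σ̂∣≡2^m m u))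
  values 1ℙ 0ℙ = trans (cong ∣_∣ (odd₀ s t)) (∣±2i∣ 0ℙ s (∣σ̂∣≡2^m m u))
  values 1ℙ 1ℙ = trans (cong ∣_∣ (even₁ s t)) (∣±2i∣ 0ℙ t (∣τ̂∣≡2^m m u))

theorem3p1 : (m : ℕ) → .{{_ : NonZero m}} → IsBent {m * 2} {{m*n≢0 m 2}} (τ m)
-- The constant is the square root of the order `2 ^ (m * 2)`, the only value compatible with
-- Parseval's identity.
theorem3p1 m = 2 ^ m , λ i → begin
  ∣ (H (m * 2) {{nz}} ·ᵛ signVector (τ m)) i ∣
    ≡⟨ cong ∣_∣ (H-walsh (m * 2) {{nz}} ([-1]^_ ∘ τ m) i) ⟩
  ∣ walsh ([-1]^_ ∘ τ m) (digits (m * 2) i) ∣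
    ≡⟨ cong ∣_∣ (walsh-cong (cong [-1]^_ ∘ τ≗τʳ m) (digits (m * 2) i)) ⟩
  ∣ τ̂ m (digits (m * 2) i) ∣
    ≡⟨ ∣τ̂∣≡2^m m (digits (m * 2) i) ⟩
  2 ^ m ∎
  where
  .nz : NonZero (m * 2)
  nz = m*n≢0 m 2
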